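{- Consider the bin packing problem with general monotone submodular capacity constraints: an instance consists of a set of jobs $[N]=\{1,\dots,N\}$, a machine capacity $V>0$ (the same for all machines), and a monotone submodular set function $f:2^{[N]}\to\mathbb{R}_{\ge 0}$ with $f(\emptyset)=0$, given by a value oracle; the goal is to partition $[N]$ into the minimum number $\mathrm{OPT}$ of sets $S$ each satisfying $f(S)\le V$. Then it is impossible to guarantee a solution within a factor better than $\frac{\sqrt{N}}{\ln(N)}$ from optimal. That is, there is no polynomial-time algorithm (in particular, making only a number of value-oracle queries polynomial in $N$) which, on every such instance admitting a feasible partition, outputs a feasible partition using at most $\rho(N)\cdot \mathrm{OPT}$ sets, where $\rho(N)<\frac{\sqrt N}{\ln(N)}$ for all $N\ge 2$.
   Context: A set function $f:2^{[N]}\to\mathbb{R}$ is monotone if $f(S)\le f(T)$ whenever $S\subseteq T$, and submodular if $f(S)+f(T)\ge f(S\cup T)+f(S\cap T)$ for all $S,T\subseteq[N]$. A value oracle for $f$ returns $f(S)$ when queried with a set $S\subseteq [N]$. A set $S$ of jobs can be scheduled on one machine if and only if $f(S)\le V$. -}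

module Defs where

open import Data.Nat as ℕ using (ℕ; zero; suc; z≤n; s≤s)
import Data.Nat.Properties as ℕₚ
import Data.Nat.Tactic.RingSolver as ℕ-Ring
open import Data.Integer as ℤ using (+_)
import Data.Integer.Properties as ℤₚ
open import Data.Rational as ℚ using (ℚ; 0ℚ; 1ℚ; ½; mkℚ)
import Data.Rational.Properties as ℚₚ
open import Data.Rational.Solver using (module +-*-Solver)
import Data.Rational.Unnormalised as ℚᵘ
import Data.Rational.Unnormalised.Properties as ℚᵘₚ
open import Data.Fin using (Fin)
open import Data.Fin.Properties using (_≟_)
open import Data.Fin.Subset using (Subset; ⊥; _⊆_; _∪_; _∩_)
open import Data.Vec using (tabulate)
open import Data.Product using (∃; ∃-syntax; Σ-syntax; _×_; _,_; proj₁; proj₂)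
open import Data.Sum using (inj₁; inj₂)
open import Relation.Nullary using (¬_; does; yes; no)
open import Relation.Binary.PropositionalEquality
  using (_≡_; refl; sym; trans; cong; cong₂; subst; subst₂)

-- Equality of reals is ≃ℝ below, not _≡_.
record ℝ : Set where
  constructor mkℝ
  field
    seq    : ℕ → ℚ
    cauchy : ∀ ε → 0ℚ ℚ.< ε → ∃[ M ] ∀ m n → M ℕ.≤ m → M ℕ.≤ n →
             ℚ.∣ seq m ℚ.- seq n ∣ ℚ.< ε

open ℝ public

infix 4 _<ℝ_ _≤ℝ_ _≃ℝ_

_<ℝ_ : ℝ → ℝ → Set
x <ℝ y = Σ[ ε ∈ ℚ ] 0ℚ ℚ.< ε × ∃[ M ] ∀ n → M ℕ.≤ n → seq x n ℚ.+ ε ℚ.≤ seq y n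

_≤ℝ_ : ℝ → ℝ → Set
x ≤ℝ y = ¬ (y <ℝ x)

_≃ℝ_ : ℝ → ℝ → Set
x ≃ℝ y = x ≤ℝ y × y ≤ℝ x

frac : ℕ → ℕ → ℚ
frac a d = + a ℚ./ suc d

frac-≤ : ∀ {a d b e} → a ℕ.* suc e ℕ.≤ b ℕ.* suc d → frac a d ℚ.≤ frac b e
frac-≤ {a} {d} {b} {e} h = ℚₚ.toℚᵘ-cancel-≤
  (ℚᵘₚ.≤-respˡ-≃ (ℚᵘₚ.≃-sym (ℚₚ.toℚᵘ-fromℚᵘ (ℚᵘ.mkℚᵘ (+ a) d)))
  (ℚᵘₚ.≤-respʳ-≃ (ℚᵘₚ.≃-sym (ℚₚ.toℚᵘ-fromℚᵘ (ℚᵘ.mkℚᵘ (+ b) e)))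
  (ℚᵘ.*≤* (subst₂ ℤ._≤_ (ℤₚ.pos-* a (suc e)) (ℤₚ.pos-* b (suc d)) (ℤ.+≤+ h)))))

frac-< : ∀ {a d b e} → a ℕ.* suc e ℕ.< b ℕ.* suc d → frac a d ℚ.< frac b e
frac-< {a} {d} {b} {e} h = ℚₚ.toℚᵘ-cancel-<
  (ℚᵘₚ.<-respˡ-≃ (ℚᵘₚ.≃-sym (ℚₚ.toℚᵘ-fromℚᵘ (ℚᵘ.mkℚᵘ (+ a) d)))
  (ℚᵘₚ.<-respʳ-≃ (ℚᵘₚ.≃-sym (ℚₚ.toℚᵘ-fromℚᵘ (ℚᵘ.mkℚᵘ (+ b) e)))
  (ℚᵘ.*<* (subst₂ ℤ._<_ (ℤₚ.pos-* a (suc e)) (ℤₚ.pos-* b (suc d)) (ℤ.+<+ h)))))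

frac-+ : ∀ a b d → frac a d ℚ.+ frac b d ≡ frac (a ℕ.+ b) d
frac-+ a b d = ℚₚ.toℚᵘ-injective
  (ℚᵘₚ.≃-trans (ℚₚ.toℚᵘ-homo-+ (frac a d) (frac b d))
  (ℚᵘₚ.≃-trans (ℚᵘₚ.+-cong (ℚₚ.toℚᵘ-fromℚᵘ (ℚᵘ.mkℚᵘ (+ a) d)) (ℚₚ.toℚᵘ-fromℚᵘ (ℚᵘ.mkℚᵘ (+ b) d)))
  (ℚᵘₚ.≃-trans (ℚᵘ.*≡* eq) (ℚᵘₚ.≃-sym (ℚₚ.toℚᵘ-fromℚᵘ (ℚᵘ.mkℚᵘ (+ (a ℕ.+ b)) d))))))
  where
  D = + suc d
  eq : (+ a ℤ.* D ℤ.+ + b ℤ.* D) ℤ.* D ≡ + (a ℕ.+ b) ℤ.* (D ℤ.* D)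
  eq = trans (cong (ℤ._* D) (sym (ℤₚ.*-distribʳ-+ D (+ a) (+ b))))
      (trans (ℤₚ.*-assoc (+ a ℤ.+ + b) D D)
             (cong (ℤ._* (D ℤ.* D)) (sym (ℤₚ.pos-+ a b))))

archimedean : ∀ ε → 0ℚ ℚ.< ε → ∃[ M ] ∀ n → M ℕ.≤ n → frac 1 n ℚ.< ε
archimedean ε@(mkℚ (+ zero) d c) 0<ε with ℚₚ.drop-*<* 0<ε
... | ℤ.+<+ ()
archimedean ε@(mkℚ (ℤ.-[1+ k ]) d c) 0<ε with ℚₚ.drop-*<* 0<ε
... | ()
archimedean ε@(mkℚ (+ suc k) d c) 0<ε = suc d , λ n h →
  subst (frac 1 n ℚ.<_) (ℚₚ.↥p/↧p≡p ε)
    (frac-< {1} {n} {suc k} {d} (ℕₚ.<-≤-trans (lem n h) (ℕₚ.m≤n*m (suc n) (suc k))))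
  where
  lem : ∀ n → suc d ℕ.≤ n → 1 ℕ.* suc d ℕ.< suc n
  lem n h = subst (ℕ._< suc n) (sym (ℕₚ.*-identityˡ (suc d))) (s≤s h)

p≡q+[p-q] : ∀ p q → p ≡ q ℚ.+ (p ℚ.- q)
p≡q+[p-q] = solve 2 (λ p q → p := q :+ (p :- q)) refl
  where open +-*-Solver

p≤∣p∣ : ∀ p → p ℚ.≤ ℚ.∣ p ∣
p≤∣p∣ p with ℚₚ.≤-total 0ℚ p
... | inj₁ 0≤p = ℚₚ.≤-reflexive (sym (ℚₚ.0≤p⇒∣p∣≡p 0≤p))
... | inj₂ p≤0 = ℚₚ.≤-trans p≤0 (ℚₚ.0≤∣p∣ p)

≤+∣-∣ : ∀ p q → p ℚ.≤ q ℚ.+ ℚ.∣ p ℚ.- q ∣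
≤+∣-∣ p q = subst (ℚ._≤ q ℚ.+ ℚ.∣ p ℚ.- q ∣) (sym (p≡q+[p-q] p q))
  (ℚₚ.+-monoʳ-≤ q (p≤∣p∣ (p ℚ.- q)))

∣-∣-comm : ∀ p q → ℚ.∣ p ℚ.- q ∣ ≡ ℚ.∣ q ℚ.- p ∣
∣-∣-comm p q = trans (sym (ℚₚ.∣-p∣≡∣p∣ (p ℚ.- q)))
  (cong ℚ.∣_∣ (solve 2 (λ p q → :- (p :- q) := q :- p) refl p q))
  where open +-*-Solver

p-q≤ : ∀ p q r → p ℚ.≤ q ℚ.+ r → p ℚ.- q ℚ.≤ r
p-q≤ p q r h = subst (p ℚ.- q ℚ.≤_)
  (solve 2 (λ q r → q :+ r :- q := r) refl q r) (ℚₚ.+-monoˡ-≤ (ℚ.- q) h)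
  where open +-*-Solver

∣-∣-≤ : ∀ p q r → p ℚ.≤ q ℚ.+ r → q ℚ.≤ p ℚ.+ r → ℚ.∣ p ℚ.- q ∣ ℚ.≤ r
∣-∣-≤ p q r h k with ℚₚ.∣p∣≡p∨∣p∣≡-p (p ℚ.- q)
... | inj₁ e = subst (ℚ._≤ r) (sym e) (p-q≤ p q r h)
... | inj₂ e = subst (ℚ._≤ r)
  (trans (solve 2 (λ p q → q :- p := :- (p :- q)) refl p q) (sym e)) (p-q≤ q p r k)
  where open +-*-Solver

0<½* : ∀ ε → 0ℚ ℚ.< ε → 0ℚ ℚ.< ½ ℚ.* ε
0<½* ε 0<ε = subst (ℚ._< ½ ℚ.* ε) (ℚₚ.*-zeroʳ ½) (ℚₚ.*-monoʳ-<-pos ½ 0<ε)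

½+½ : ∀ ε → ½ ℚ.* ε ℚ.+ ½ ℚ.* ε ≡ ε
½+½ ε = trans (sym (ℚₚ.*-distribʳ-+ ε ½ ½)) (ℚₚ.*-identityˡ ε)

rate⇒cauchy : (s : ℕ → ℚ) → (∀ m n → s m ℚ.≤ s n ℚ.+ frac 1 n) →
  ∀ ε → 0ℚ ℚ.< ε → ∃[ M ] ∀ m n → M ℕ.≤ m → M ℕ.≤ n → ℚ.∣ s m ℚ.- s n ∣ ℚ.< ε
rate⇒cauchy s h ε 0<ε with archimedean ε 0<ε
... | M , small = M , λ m n M≤m M≤n →
  ℚₚ.≤-<-trans (∣-∣-≤ (s m) (s n) (frac 1 m ℚ.⊔ frac 1 n)
      (ℚₚ.≤-trans (h m n) (ℚₚ.+-monoʳ-≤ (s n) (ℚₚ.p≤q⊔p (frac 1 m) (frac 1 n))))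
      (ℚₚ.≤-trans (h n m) (ℚₚ.+-monoʳ-≤ (s m) (ℚₚ.p≤p⊔q (frac 1 m) (frac 1 n)))))
    (⊔-< (frac 1 m) (frac 1 n) (small m M≤m) (small n M≤n))
  where
  ⊔-< : ∀ p q {r} → p ℚ.< r → q ℚ.< r → p ℚ.⊔ q ℚ.< r
  ⊔-< p q {r} p<r q<r with ℚₚ.⊔-sel p q
  ... | inj₁ e = subst (ℚ._< r) (sym e) p<r
  ... | inj₂ e = subst (ℚ._< r) (sym e) q<r

fromℚ : ℚ → ℝ
fromℚ p = mkℝ (λ _ → p) λ ε 0<ε → 0 , λ _ _ _ _ →
  subst (ℚ._< ε) (sym (cong ℚ.∣_∣ (ℚₚ.+-inverseʳ p))) 0<ε

fromℕ : ℕ → ℝ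
fromℕ n = fromℚ (+ n ℚ./ 1)

0ℝ : ℝ
0ℝ = fromℚ 0ℚ

infixl 6 _+ℝ_
infixl 7 _*ℝ_

_+ℝ_ : ℝ → ℝ → ℝ
x +ℝ y = mkℝ (λ n → seq x n ℚ.+ seq y n) c
  where
  open +-*-Solver
  c : ∀ ε → 0ℚ ℚ.< ε → ∃[ M ] ∀ m n → M ℕ.≤ m → M ℕ.≤ n →
      ℚ.∣ (seq x m ℚ.+ seq y m) ℚ.- (seq x n ℚ.+ seq y n) ∣ ℚ.< ε
  c ε 0<ε with cauchy x (½ ℚ.* ε) (0<½* ε 0<ε) | cauchy y (½ ℚ.* ε) (0<½* ε 0<ε)
  ... | M₁ , h₁ | M₂ , h₂ = M₁ ℕ.⊔ M₂ , λ m n M≤m M≤n →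
    let a = seq x m ; b = seq y m ; a′ = seq x n ; b′ = seq y n in
    ℚₚ.≤-<-trans
      (subst (λ z → ℚ.∣ z ∣ ℚ.≤ ℚ.∣ a ℚ.- a′ ∣ ℚ.+ ℚ.∣ b ℚ.- b′ ∣)
        (solve 4 (λ a b a′ b′ → (a :- a′) :+ (b :- b′) := (a :+ b) :- (a′ :+ b′)) refl a b a′ b′)
        (ℚₚ.∣p+q∣≤∣p∣+∣q∣ (a ℚ.- a′) (b ℚ.- b′)))
      (subst (ℚ.∣ a ℚ.- a′ ∣ ℚ.+ ℚ.∣ b ℚ.- b′ ∣ ℚ.<_) (½+½ ε)
        (ℚₚ.+-mono-<
          (h₁ m n (ℕₚ.m⊔n≤o⇒m≤o M₁ M₂ M≤m) (ℕₚ.m⊔n≤o⇒m≤o M₁ M₂ M≤n))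
          (h₂ m n (ℕₚ.m⊔n≤o⇒n≤o M₁ M₂ M≤m) (ℕₚ.m⊔n≤o⇒n≤o M₁ M₂ M≤n))))

scale : (B : ℚ) → 0ℚ ℚ.< B → (ε : ℚ) → 0ℚ ℚ.< ε → Σ[ δ ∈ ℚ ] 0ℚ ℚ.< δ × B ℚ.* δ ≡ ε
scale B 0<B ε 0<ε = δ , 0<δ , eq
  where
  instance
    B⁺ : ℚ.Positive B
    B⁺ = ℚ.positive 0<B
    B≠0 : ℚ.NonZero B
    B≠0 = ℚₚ.pos⇒nonZero B
    B⁻¹⁺ : ℚ.Positive (ℚ.1/ B)
    B⁻¹⁺ = ℚₚ.1/pos⇒pos B
  δ = ℚ.1/ B ℚ.* ε
  0<δ : 0ℚ ℚ.< δ
  0<δ = subst (ℚ._< δ) (ℚₚ.*-zeroʳ (ℚ.1/ B)) (ℚₚ.*-monoʳ-<-pos (ℚ.1/ B) 0<ε)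
  eq : B ℚ.* δ ≡ ε
  eq = trans (sym (ℚₚ.*-assoc B (ℚ.1/ B) ε))
      (trans (cong (ℚ._* ε) (ℚₚ.*-inverseʳ B)) (ℚₚ.*-identityˡ ε))

0<1 : 0ℚ ℚ.< 1ℚ
0<1 = ℚₚ.positive⁻¹ 1ℚ

bound : (x : ℝ) → Σ[ B ∈ ℚ ] 0ℚ ℚ.< B × ∃[ M ] ∀ n → M ℕ.≤ n → ℚ.∣ seq x n ∣ ℚ.≤ B
bound x with cauchy x 1ℚ 0<1
... | M , h = ℚ.∣ seq x M ∣ ℚ.+ 1ℚ , 0<B , M , λ n M≤n →
  ℚₚ.≤-trans
    (subst (λ z → ℚ.∣ z ∣ ℚ.≤ ℚ.∣ seq x M ∣ ℚ.+ ℚ.∣ seq x n ℚ.- seq x M ∣)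
      (sym (p≡q+[p-q] (seq x n) (seq x M)))
      (ℚₚ.∣p+q∣≤∣p∣+∣q∣ (seq x M) (seq x n ℚ.- seq x M)))
    (ℚₚ.+-monoʳ-≤ ℚ.∣ seq x M ∣ (ℚₚ.<⇒≤ (h n M M≤n ℕₚ.≤-refl)))
  where
  0<B : 0ℚ ℚ.< ℚ.∣ seq x M ∣ ℚ.+ 1ℚ
  0<B = ℚₚ.<-≤-trans 0<1 (subst (ℚ._≤ ℚ.∣ seq x M ∣ ℚ.+ 1ℚ) (ℚₚ.+-identityˡ 1ℚ)
    (ℚₚ.+-monoˡ-≤ 1ℚ (ℚₚ.0≤∣p∣ (seq x M))))

∣*∣-< : ∀ {p q B δ} → 0ℚ ℚ.< B → ℚ.∣ p ∣ ℚ.≤ B → ℚ.∣ q ∣ ℚ.< δ → ℚ.∣ p ℚ.* q ∣ ℚ.< B ℚ.* δ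
∣*∣-< {p} {q} {B} {δ} 0<B p≤B q<δ = subst (ℚ._< B ℚ.* δ) (sym (ℚₚ.∣p*q∣≡∣p∣*∣q∣ p q))
  (ℚₚ.≤-<-trans
    (ℚₚ.*-monoʳ-≤-nonNeg ℚ.∣ q ∣ ⦃ ℚₚ.∣-∣-nonNeg q ⦄ p≤B)
    (ℚₚ.*-monoʳ-<-pos B ⦃ ℚ.positive 0<B ⦄ q<δ))

*-split : ∀ a b a′ b′ → a ℚ.* (b ℚ.- b′) ℚ.+ b′ ℚ.* (a ℚ.- a′) ≡ a ℚ.* b ℚ.- a′ ℚ.* b′
*-split = solve 4 (λ a b a′ b′ → a :* (b :- b′) :+ b′ :* (a :- a′) := a :* b :- a′ :* b′) refl
  where open +-*-Solver

*-close : ∀ {A B} a b a′ b′ α β ε → 0ℚ ℚ.< A → 0ℚ ℚ.< B → ℚ.∣ a ∣ ℚ.≤ A → ℚ.∣ b′ ∣ ℚ.≤ B →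
  ℚ.∣ b ℚ.- b′ ∣ ℚ.< α → ℚ.∣ a ℚ.- a′ ∣ ℚ.< β → A ℚ.* α ≡ ½ ℚ.* ε → B ℚ.* β ≡ ½ ℚ.* ε →
  ℚ.∣ a ℚ.* b ℚ.- a′ ℚ.* b′ ∣ ℚ.< ε
*-close {A} {B} a b a′ b′ α β ε 0<A 0<B a≤A b′≤B hb ha Aα Bβ = begin-strict
  ℚ.∣ a ℚ.* b ℚ.- a′ ℚ.* b′ ∣                             ≡⟨ cong ℚ.∣_∣ (sym (*-split a b a′ b′)) ⟩
  ℚ.∣ a ℚ.* (b ℚ.- b′) ℚ.+ b′ ℚ.* (a ℚ.- a′) ∣            ≤⟨ ℚₚ.∣p+q∣≤∣p∣+∣q∣ (a ℚ.* (b ℚ.- b′)) (b′ ℚ.* (a ℚ.- a′)) ⟩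
  ℚ.∣ a ℚ.* (b ℚ.- b′) ∣ ℚ.+ ℚ.∣ b′ ℚ.* (a ℚ.- a′) ∣      <⟨ ℚₚ.+-mono-< (∣*∣-< {a} {b ℚ.- b′} 0<A a≤A hb) (∣*∣-< {b′} {a ℚ.- a′} 0<B b′≤B ha) ⟩
  A ℚ.* α ℚ.+ B ℚ.* β                                     ≡⟨ trans (cong₂ ℚ._+_ Aα Bβ) (½+½ ε) ⟩
  ε                                                       ∎
  where open ℚₚ.≤-Reasoning

_*ℝ_ : ℝ → ℝ → ℝ
x *ℝ y = mkℝ (λ n → seq x n ℚ.* seq y n) c
  where
  c : ∀ ε → 0ℚ ℚ.< ε → ∃[ M ] ∀ m n → M ℕ.≤ m → M ℕ.≤ n →
      ℚ.∣ seq x m ℚ.* seq y m ℚ.- seq x n ℚ.* seq y n ∣ ℚ.< ε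
  c ε 0<ε =
    let
      A , 0<A , M₁ , hA = bound x
      B , 0<B , M₂ , hB = bound y
      α , 0<α , Aα = scale A 0<A (½ ℚ.* ε) (0<½* ε 0<ε)
      β , 0<β , Bβ = scale B 0<B (½ ℚ.* ε) (0<½* ε 0<ε)
      M₃ , hy = cauchy y α 0<α
      M₄ , hx = cauchy x β 0<β
    in
    (M₁ ℕ.⊔ M₂) ℕ.⊔ (M₃ ℕ.⊔ M₄) , λ m n M≤m M≤n →
    let
      m₁₂ = ℕₚ.m⊔n≤o⇒m≤o (M₁ ℕ.⊔ M₂) (M₃ ℕ.⊔ M₄) M≤m
      m₃₄ = ℕₚ.m⊔n≤o⇒n≤o (M₁ ℕ.⊔ M₂) (M₃ ℕ.⊔ M₄) M≤m
      n₁₂ = ℕₚ.m⊔n≤o⇒m≤o (M₁ ℕ.⊔ M₂) (M₃ ℕ.⊔ M₄) M≤n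
      n₃₄ = ℕₚ.m⊔n≤o⇒n≤o (M₁ ℕ.⊔ M₂) (M₃ ℕ.⊔ M₄) M≤n
    in
    *-close (seq x m) (seq y m) (seq x n) (seq y n) α β ε 0<A 0<B
      (hA m (ℕₚ.m⊔n≤o⇒m≤o M₁ M₂ m₁₂)) (hB n (ℕₚ.m⊔n≤o⇒n≤o M₁ M₂ n₁₂))
      (hy m n (ℕₚ.m⊔n≤o⇒m≤o M₃ M₄ m₃₄) (ℕₚ.m⊔n≤o⇒m≤o M₃ M₄ n₃₄))
      (hx m n (ℕₚ.m⊔n≤o⇒n≤o M₃ M₄ m₃₄) (ℕₚ.m⊔n≤o⇒n≤o M₃ M₄ n₃₄))
      Aα Bβ

⊔-nonZero : ∀ {e} → 0ℚ ℚ.< e → ∀ p → ℚ.NonZero (e ℚ.⊔ p)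
⊔-nonZero {e} 0<e p = ℚ.>-nonZero (ℚₚ.<-≤-trans 0<e (ℚₚ.p≤p⊔q e p))

⊔-lipschitz : ∀ e p q → ℚ.∣ (e ℚ.⊔ p) ℚ.- (e ℚ.⊔ q) ∣ ℚ.≤ ℚ.∣ p ℚ.- q ∣
⊔-lipschitz e p q = ∣-∣-≤ (e ℚ.⊔ p) (e ℚ.⊔ q) ℚ.∣ p ℚ.- q ∣ (one p q)
  (subst (λ r → e ℚ.⊔ q ℚ.≤ e ℚ.⊔ p ℚ.+ r) (∣-∣-comm q p) (one q p))
  where
  one : ∀ p q → e ℚ.⊔ p ℚ.≤ (e ℚ.⊔ q) ℚ.+ ℚ.∣ p ℚ.- q ∣
  one p q = ℚₚ.⊔-lub
    (subst (ℚ._≤ (e ℚ.⊔ q) ℚ.+ ℚ.∣ p ℚ.- q ∣) (ℚₚ.+-identityʳ e)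
      (ℚₚ.+-mono-≤ (ℚₚ.p≤p⊔q e q) (ℚₚ.0≤∣p∣ (p ℚ.- q))))
    (ℚₚ.≤-trans (≤+∣-∣ p q) (ℚₚ.+-monoˡ-≤ ℚ.∣ p ℚ.- q ∣ (ℚₚ.p≤q⊔p e q)))

1/-split : ∀ u v i j → (u ℚ.* v) ℚ.* (i ℚ.- j) ≡ (u ℚ.* i) ℚ.* v ℚ.- (v ℚ.* j) ℚ.* u
1/-split = solve 4 (λ u v i j → (u :* v) :* (i :- j) := (u :* i) :* v :- (v :* j) :* u) refl
  where open +-*-Solver

1/-close : ∀ e u v → .⦃ _ : ℚ.NonZero u ⦄ .⦃ _ : ℚ.NonZero v ⦄ → 0ℚ ℚ.< e → e ℚ.≤ u → e ℚ.≤ v →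
  ∀ ε → 0ℚ ℚ.< ε → ℚ.∣ u ℚ.- v ∣ ℚ.< (e ℚ.* e) ℚ.* ε → ℚ.∣ ℚ.1/ u ℚ.- ℚ.1/ v ∣ ℚ.< ε
1/-close e u v 0<e e≤u e≤v ε 0<ε h = ℚₚ.*-cancelˡ-<-nonNeg (u ℚ.* v) (subst (ℚ._< (u ℚ.* v) ℚ.* ε) eq
    (ℚₚ.<-≤-trans h (ℚₚ.*-monoʳ-≤-nonNeg ε ee≤uv)))
  where
  instance
    e⁺ : ℚ.Positive e
    e⁺ = ℚ.positive 0<e
    u⁺ : ℚ.Positive u
    u⁺ = ℚ.positive (ℚₚ.<-≤-trans 0<e e≤u)
    v⁺ : ℚ.Positive v
    v⁺ = ℚ.positive (ℚₚ.<-≤-trans 0<e e≤v)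
    e⁰ : ℚ.NonNegative e
    e⁰ = ℚₚ.pos⇒nonNeg e
    v⁰ : ℚ.NonNegative v
    v⁰ = ℚₚ.pos⇒nonNeg v
    uv⁰ : ℚ.NonNegative (u ℚ.* v)
    uv⁰ = ℚₚ.pos⇒nonNeg (u ℚ.* v) ⦃ ℚₚ.pos*pos⇒pos u v ⦄
    ε⁰ : ℚ.NonNegative ε
    ε⁰ = ℚₚ.pos⇒nonNeg ε ⦃ ℚ.positive 0<ε ⦄
  ee≤uv : e ℚ.* e ℚ.≤ u ℚ.* v
  ee≤uv = ℚₚ.≤-trans (ℚₚ.*-monoˡ-≤-nonNeg e e≤v) (ℚₚ.*-monoʳ-≤-nonNeg v e≤u)
  flip : (u ℚ.* v) ℚ.* (ℚ.1/ u ℚ.- ℚ.1/ v) ≡ v ℚ.- u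
  flip = trans
    (1/-split u v (ℚ.1/ u) (ℚ.1/ v))
    (cong₂ (λ a b → a ℚ.- b)
      (trans (cong (ℚ._* v) (ℚₚ.*-inverseʳ u)) (ℚₚ.*-identityˡ v))
      (trans (cong (ℚ._* u) (ℚₚ.*-inverseʳ v)) (ℚₚ.*-identityˡ u)))
  eq : ℚ.∣ u ℚ.- v ∣ ≡ (u ℚ.* v) ℚ.* ℚ.∣ ℚ.1/ u ℚ.- ℚ.1/ v ∣
  eq = trans (∣-∣-comm u v) (trans (cong ℚ.∣_∣ (sym flip))
    (trans (ℚₚ.∣p*q∣≡∣p∣*∣q∣ (u ℚ.* v) (ℚ.1/ u ℚ.- ℚ.1/ v))
      (cong (ℚ._* ℚ.∣ ℚ.1/ u ℚ.- ℚ.1/ v ∣) (ℚₚ.0≤p⇒∣p∣≡p (ℚₚ.nonNegative⁻¹ (u ℚ.* v))))))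

-- If e > 0 bounds seq y from below eventually, then e ⊔ seq y n agrees with
-- seq y n for all large n; truncating makes every term invertible.
inv : (y : ℝ) → 0ℝ <ℝ y → ℝ
inv y (e , 0<e , _) = mkℝ (λ n → (ℚ.1/ (e ℚ.⊔ seq y n)) ⦃ ⊔-nonZero 0<e (seq y n) ⦄) c
  where
  instance
    e⁺ : ℚ.Positive e
    e⁺ = ℚ.positive 0<e
  c : ∀ ε → 0ℚ ℚ.< ε → ∃[ M ] ∀ m n → M ℕ.≤ m → M ℕ.≤ n →
      ℚ.∣ (ℚ.1/ (e ℚ.⊔ seq y m)) ⦃ ⊔-nonZero 0<e (seq y m) ⦄
        ℚ.- (ℚ.1/ (e ℚ.⊔ seq y n)) ⦃ ⊔-nonZero 0<e (seq y n) ⦄ ∣ ℚ.< ε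
  c ε 0<ε with cauchy y ((e ℚ.* e) ℚ.* ε)
                 (ℚₚ.positive⁻¹ _ ⦃ ℚₚ.pos*pos⇒pos (e ℚ.* e) ⦃ ℚₚ.pos*pos⇒pos e e ⦄ ε ⦃ ℚ.positive 0<ε ⦄ ⦄)
  ... | M , h = M , λ m n M≤m M≤n →
    1/-close e (e ℚ.⊔ seq y m) (e ℚ.⊔ seq y n)
      ⦃ ⊔-nonZero 0<e (seq y m) ⦄ ⦃ ⊔-nonZero 0<e (seq y n) ⦄
      0<e (ℚₚ.p≤p⊔q e (seq y m)) (ℚₚ.p≤p⊔q e (seq y n)) ε 0<ε
      (ℚₚ.≤-<-trans (⊔-lipschitz e (seq y m) (seq y n)) (h m n M≤m M≤n))

infixl 7 _/ℝ_⟨_⟩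

_/ℝ_⟨_⟩ : (x y : ℝ) → 0ℝ <ℝ y → ℝ
x /ℝ y ⟨ 0<y ⟩ = x *ℝ inv y 0<y

⌊√_⌋ : ℕ → ℕ
⌊√ zero ⌋ = zero
⌊√ suc m ⌋ with suc ⌊√ m ⌋ ℕ.* suc ⌊√ m ⌋ ℕ.≤? suc m
... | yes _ = suc ⌊√ m ⌋
... | no  _ = ⌊√ m ⌋

⌊√⌋-lower : ∀ m → ⌊√ m ⌋ ℕ.* ⌊√ m ⌋ ℕ.≤ m
⌊√⌋-lower zero = z≤n
⌊√⌋-lower (suc m) with suc ⌊√ m ⌋ ℕ.* suc ⌊√ m ⌋ ℕ.≤? suc m
... | yes h = h
... | no  _ = ℕₚ.m≤n⇒m≤1+n (⌊√⌋-lower m)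

⌊√⌋-upper : ∀ m → m ℕ.< suc ⌊√ m ⌋ ℕ.* suc ⌊√ m ⌋
⌊√⌋-upper zero = s≤s z≤n
⌊√⌋-upper (suc m) with suc ⌊√ m ⌋ ℕ.* suc ⌊√ m ⌋ ℕ.≤? suc m
... | yes _ = ℕₚ.≤-<-trans (⌊√⌋-upper m) (ℕₚ.*-mono-< (ℕₚ.n<1+n k) (ℕₚ.n<1+n k))
  where k = suc ⌊√ m ⌋
... | no  h = ℕₚ.≰⇒> h

-- √N = lim ⌊√(N(n+1)²)⌋ / (n+1)
√_ : ℕ → ℝ
√ N = mkℝ s (rate⇒cauchy s rate)
  where
  r : ℕ → ℕ
  r n = ⌊√ N ℕ.* (suc n ℕ.* suc n) ⌋
  s : ℕ → ℚ
  s n = + r n ℚ./ suc n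
  rate : ∀ m n → s m ℚ.≤ s n ℚ.+ frac 1 n
  rate m n = subst (s m ℚ.≤_) (sym (frac-+ (r n) 1 n))
    (frac-≤ {r m} {m} {r n ℕ.+ 1} {n} (ℕₚ.≮⇒≥ λ lt → ℕₚ.<-irrefl refl (chain lt)))
    where
    open ℕₚ.≤-Reasoning
    a = r m
    b = r n
    m′ = suc m
    n′ = suc n
    shuffle : ∀ a b c d → (a ℕ.* b) ℕ.* (c ℕ.* d) ≡ (a ℕ.* c) ℕ.* (b ℕ.* d)
    shuffle = ℕ-Ring.solve-∀
    swap : ∀ a b c → (a ℕ.* b) ℕ.* c ≡ (a ℕ.* c) ℕ.* b
    swap = ℕ-Ring.solve-∀
    chain : (b ℕ.+ 1) ℕ.* m′ ℕ.< a ℕ.* n′ → N ℕ.* (m′ ℕ.* m′) ℕ.* (n′ ℕ.* n′) ℕ.< N ℕ.* (m′ ℕ.* m′) ℕ.* (n′ ℕ.* n′)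
    chain lt = begin-strict
      N ℕ.* (m′ ℕ.* m′) ℕ.* (n′ ℕ.* n′)         ≡⟨ swap N (m′ ℕ.* m′) (n′ ℕ.* n′) ⟩
      N ℕ.* (n′ ℕ.* n′) ℕ.* (m′ ℕ.* m′)         ≤⟨ ℕₚ.*-monoˡ-≤ (m′ ℕ.* m′) (ℕₚ.<⇒≤ (⌊√⌋-upper (N ℕ.* (n′ ℕ.* n′)))) ⟩
      (suc b ℕ.* suc b) ℕ.* (m′ ℕ.* m′)         ≡⟨ cong (λ t → (t ℕ.* t) ℕ.* (m′ ℕ.* m′)) (ℕₚ.+-comm 1 b) ⟩
      ((b ℕ.+ 1) ℕ.* (b ℕ.+ 1)) ℕ.* (m′ ℕ.* m′) ≡⟨ shuffle (b ℕ.+ 1) (b ℕ.+ 1) m′ m′ ⟩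
      ((b ℕ.+ 1) ℕ.* m′) ℕ.* ((b ℕ.+ 1) ℕ.* m′) <⟨ ℕₚ.*-mono-< lt lt ⟩
      (a ℕ.* n′) ℕ.* (a ℕ.* n′)                 ≡⟨ shuffle a n′ a n′ ⟩
      (a ℕ.* a) ℕ.* (n′ ℕ.* n′)                 ≤⟨ ℕₚ.*-monoˡ-≤ (n′ ℕ.* n′) (⌊√⌋-lower (N ℕ.* (m′ ℕ.* m′))) ⟩
      N ℕ.* (m′ ℕ.* m′) ℕ.* (n′ ℕ.* n′)         ∎

∑< : ℕ → (ℕ → ℚ) → ℚ
∑< zero    g = 0ℚ
∑< (suc K) g = ∑< K g ℚ.+ g K

∑-mono : ∀ K {g h} → (∀ k → g k ℚ.≤ h k) → ∑< K g ℚ.≤ ∑< K h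
∑-mono zero    le = ℚₚ.≤-refl
∑-mono (suc K) le = ℚₚ.+-mono-≤ (∑-mono K le) (le K)

∑-split : ∀ A B g → ∑< (A ℕ.+ B) g ≡ ∑< A g ℚ.+ ∑< B (λ k → g (A ℕ.+ k))
∑-split A zero    g = trans (cong (λ z → ∑< z g) (ℕₚ.+-identityʳ A)) (sym (ℚₚ.+-identityʳ _))
∑-split A (suc B) g = trans (cong (λ z → ∑< z g) (ℕₚ.+-suc A B))
  (trans (cong (ℚ._+ g (A ℕ.+ B)) (∑-split A B g)) (ℚₚ.+-assoc (∑< A g) _ _))

∑-group : ∀ K b g → ∑< (K ℕ.* b) g ≡ ∑< K (λ k → ∑< b (λ j → g (k ℕ.* b ℕ.+ j)))
∑-group zero    b g = refl
∑-group (suc K) b g = trans (cong (λ z → ∑< z g) (ℕₚ.+-comm b (K ℕ.* b)))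
  (trans (∑-split (K ℕ.* b) b g)
    (cong (ℚ._+ ∑< b (λ j → g (K ℕ.* b ℕ.+ j))) (∑-group K b g)))

∑-shift : ∀ K g → ∑< K g ℚ.+ g K ≡ g 0 ℚ.+ ∑< K (λ k → g (suc k))
∑-shift K g = trans (∑-split 1 K g) (cong (ℚ._+ ∑< K (λ k → g (suc k))) (ℚₚ.+-identityˡ (g 0)))

∑-frac : ∀ K c d → ∑< K (λ _ → frac c d) ≡ frac (K ℕ.* c) d
∑-frac zero    c d = sym (ℚₚ.0/n≡0 (suc d))
∑-frac (suc K) c d = trans (cong (ℚ._+ frac c d) (∑-frac K c d))
  (trans (frac-+ (K ℕ.* c) c d) (cong (λ z → frac z d) (ℕₚ.+-comm (K ℕ.* c) c)))

0≤frac : ∀ a d → 0ℚ ℚ.≤ frac a d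
0≤frac a d = subst (ℚ._≤ frac a d) (ℚₚ.0/n≡0 1) (frac-≤ {0} {0} {a} {d} z≤n)

∑-mono< : ∀ K {g h} → (∀ k → k ℕ.< K → g k ℚ.≤ h k) → ∑< K g ℚ.≤ ∑< K h
∑-mono< zero    le = ℚₚ.≤-refl
∑-mono< (suc K) le = ℚₚ.+-mono-≤ (∑-mono< K (λ k k<K → le k (ℕₚ.m≤n⇒m≤1+n k<K))) (le K ℕₚ.≤-refl)

-- Lower Riemann sum of ∫₁ᴺ dt/t with mesh h = 1/(n+1): the k-th cell
-- contributes h / (1 + (k+1)h) = 1 / (n+1 + (k+1)).
lnSum : ℕ → ℕ → ℚ
lnSum N n = ∑< ((N ℕ.∸ 1) ℕ.* suc n) (λ k → + 1 ℚ./ suc (suc n ℕ.+ k))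

coarse≤fine : ∀ N m n → lnSum N m ℚ.≤ lnSum N (n ℕ.+ m ℕ.* suc n)
coarse≤fine N m n = subst (lnSum N m ℚ.≤_) (sym regroup) (∑-mono K cell)
  where
  m′ = suc m
  n′ = suc n
  K = (N ℕ.∸ 1) ℕ.* m′
  g : ℕ → ℚ
  g k = frac 1 (m′ ℕ.* n′ ℕ.+ k)
  regroup : lnSum N (n ℕ.+ m ℕ.* n′) ≡ ∑< K (λ k → ∑< n′ (λ j → g (k ℕ.* n′ ℕ.+ j)))
  regroup = trans (cong (λ z → ∑< z g) (sym (ℕₚ.*-assoc (N ℕ.∸ 1) m′ n′))) (∑-group K n′ g)
  cell : ∀ k → frac 1 (m′ ℕ.+ k) ℚ.≤ ∑< n′ (λ j → g (k ℕ.* n′ ℕ.+ j))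
  cell k = ℚₚ.≤-trans step₁ (ℚₚ.≤-trans (ℚₚ.≤-reflexive (sym (∑-frac n′ 1 d)))
    (∑-mono< n′ (λ j j<n′ → frac-≤ {1} {d} {1} {m′ ℕ.* n′ ℕ.+ (k ℕ.* n′ ℕ.+ j)}
      (ℕₚ.*-monoʳ-≤ 1 (s≤s (le j j<n′))))))
    where
    d = m′ ℕ.* n′ ℕ.+ (k ℕ.* n′ ℕ.+ n)
    le : ∀ j → j ℕ.< n′ → m′ ℕ.* n′ ℕ.+ (k ℕ.* n′ ℕ.+ j) ℕ.≤ d
    le j (s≤s j≤n) = ℕₚ.+-monoʳ-≤ (m′ ℕ.* n′) (ℕₚ.+-monoʳ-≤ (k ℕ.* n′) j≤n)
    eq : ∀ m n k → 1 ℕ.* suc (suc m ℕ.* suc n ℕ.+ (k ℕ.* suc n ℕ.+ n)) ≡ (suc n ℕ.* 1) ℕ.* suc (suc m ℕ.+ k)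
    eq = ℕ-Ring.solve-∀
    step₁ : frac 1 (m′ ℕ.+ k) ℚ.≤ frac (n′ ℕ.* 1) d
    step₁ = frac-≤ {1} {m′ ℕ.+ k} {n′ ℕ.* 1} {d} (ℕₚ.≤-reflexive (eq m n k))

fine≤coarse : ∀ N m n → lnSum N (m ℕ.+ n ℕ.* suc m) ℚ.≤ lnSum N n ℚ.+ frac 1 n
fine≤coarse N m n = ℚₚ.≤-trans (subst (ℚ._≤ ∑< K u) (sym regroup) (∑-mono K cell)) upper≤
  where
  m′ = suc m
  n′ = suc n
  K = (N ℕ.∸ 1) ℕ.* n′
  g u : ℕ → ℚ
  g k = frac 1 (n′ ℕ.* m′ ℕ.+ k)
  u k = frac 1 (n ℕ.+ k)
  regroup : lnSum N (m ℕ.+ n ℕ.* m′) ≡ ∑< K (λ k → ∑< m′ (λ j → g (k ℕ.* m′ ℕ.+ j)))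
  regroup = trans (cong (λ z → ∑< z g) (sym (ℕₚ.*-assoc (N ℕ.∸ 1) n′ m′))) (∑-group K m′ g)
  cell : ∀ k → ∑< m′ (λ j → g (k ℕ.* m′ ℕ.+ j)) ℚ.≤ u k
  cell k = ℚₚ.≤-trans (∑-mono m′ (λ j → frac-≤ {1} {n′ ℕ.* m′ ℕ.+ (k ℕ.* m′ ℕ.+ j)} {1} {d} (ℕₚ.*-monoʳ-≤ 1 (le j))))
    (ℚₚ.≤-trans (ℚₚ.≤-reflexive (∑-frac m′ 1 d))
      (frac-≤ {m′ ℕ.* 1} {d} {1} {n ℕ.+ k} (ℕₚ.≤-reflexive (eq m n k))))
    where
    d = m ℕ.+ (n ℕ.+ k) ℕ.* m′
    eq : ∀ m n k → (suc m ℕ.* 1) ℕ.* suc (n ℕ.+ k) ≡ 1 ℕ.* suc (m ℕ.+ (n ℕ.+ k) ℕ.* suc m)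
    eq = ℕ-Ring.solve-∀
    eq′ : ∀ m n k j → suc (suc n ℕ.* suc m ℕ.+ (k ℕ.* suc m ℕ.+ j)) ≡ suc (m ℕ.+ (n ℕ.+ k) ℕ.* suc m) ℕ.+ suc j
    eq′ = ℕ-Ring.solve-∀
    le : ∀ j → suc d ℕ.≤ suc (n′ ℕ.* m′ ℕ.+ (k ℕ.* m′ ℕ.+ j))
    le j = subst (suc d ℕ.≤_) (sym (eq′ m n k j)) (ℕₚ.m≤m+n (suc d) (suc j))
  upper≤ : ∑< K u ℚ.≤ lnSum N n ℚ.+ frac 1 n
  upper≤ = ℚₚ.≤-trans
    (subst (ℚ._≤ ∑< K u ℚ.+ u K) (ℚₚ.+-identityʳ (∑< K u)) (ℚₚ.+-monoʳ-≤ (∑< K u) (0≤frac 1 (n ℕ.+ K))))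
    (ℚₚ.≤-reflexive (trans (∑-shift K u) (trans (ℚₚ.+-comm (u 0) _)
      (cong₂ ℚ._+_ (∑-cong K λ k → cong (frac 1) (ℕₚ.+-suc n k)) (cong (frac 1) (ℕₚ.+-identityʳ n))))))
    where
    ∑-cong : ∀ K {g h} → (∀ k → g k ≡ h k) → ∑< K g ≡ ∑< K h
    ∑-cong zero    e = refl
    ∑-cong (suc K) e = cong₂ ℚ._+_ (∑-cong K e) (e K)

-- ln N = ∫₁ᴺ dt/t; only meaningful for N ≥ 1.
ln : ℕ → ℝ
ln N = mkℝ (lnSum N) (rate⇒cauchy (lnSum N) λ m n →
  ℚₚ.≤-trans (coarse≤fine N m n)
    (subst (λ z → lnSum N z ℚ.≤ lnSum N n ℚ.+ frac 1 n) (sym (same m n)) (fine≤coarse N m n)))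
  where
  same : ∀ m n → n ℕ.+ m ℕ.* suc n ≡ m ℕ.+ n ℕ.* suc m
  same = ℕ-Ring.solve-∀

ln-pos : ∀ {N} → 2 ℕ.≤ N → 0ℝ <ℝ ln N
ln-pos {suc (suc N)} (s≤s (s≤s z≤n)) = ½ , ℚₚ.positive⁻¹ ½ , 0 , λ n _ →
  subst (ℚ._≤ lnSum (suc (suc N)) n) (sym (ℚₚ.+-identityˡ ½)) (half n)
  where
  half : ∀ n → ½ ℚ.≤ lnSum (suc (suc N)) n
  half n = ℚₚ.≤-trans first (subst (∑< n′ g ℚ.≤_) (sym (∑-split n′ R g))
      (subst (ℚ._≤ ∑< n′ g ℚ.+ ∑< R (λ k → g (n′ ℕ.+ k))) (ℚₚ.+-identityʳ (∑< n′ g))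
        (ℚₚ.+-monoʳ-≤ (∑< n′ g) (0≤∑ R (λ k → 0≤frac 1 (n′ ℕ.+ (n′ ℕ.+ k)))))))
    where
    n′ = suc n
    R = N ℕ.* n′
    g : ℕ → ℚ
    g k = frac 1 (n′ ℕ.+ k)
    0≤∑ : ∀ K {h : ℕ → ℚ} → (∀ k → 0ℚ ℚ.≤ h k) → 0ℚ ℚ.≤ ∑< K h
    0≤∑ zero    p = ℚₚ.≤-refl
    0≤∑ (suc K) {h} p = subst (ℚ._≤ ∑< K h ℚ.+ h K) (ℚₚ.+-identityʳ 0ℚ) (ℚₚ.+-mono-≤ (0≤∑ K p) (p K))
    eq : ∀ n → 1 ℕ.* suc (suc n ℕ.+ n) ≡ (suc n ℕ.* 1) ℕ.* 2
    eq = ℕ-Ring.solve-∀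
    first : ½ ℚ.≤ ∑< n′ g
    first = ℚₚ.≤-trans (frac-≤ {1} {1} {n′ ℕ.* 1} {n′ ℕ.+ n} (ℕₚ.≤-reflexive (eq n)))
      (ℚₚ.≤-trans (ℚₚ.≤-reflexive (sym (∑-frac n′ 1 (n′ ℕ.+ n))))
        (∑-mono< n′ λ { k (s≤s k≤n) → frac-≤ {1} {n′ ℕ.+ n} {1} {n′ ℕ.+ k}
          (ℕₚ.*-monoʳ-≤ 1 (s≤s (ℕₚ.+-monoʳ-≤ n′ k≤n))) }))

SetFunction : ℕ → Set
SetFunction N = Subset N → ℝ

Monotone : ∀ {N} → SetFunction N → Set
Monotone f = ∀ S T → S ⊆ T → f S ≤ℝ f T

Submodular : ∀ {N} → SetFunction N → Set
Submodular f = ∀ S T → f (S ∪ T) +ℝ f (S ∩ T) ≤ℝ f S +ℝ f T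

record Instance (N : ℕ) : Set where
  field
    V          : ℝ
    V-positive : 0ℝ <ℝ V
    f          : SetFunction N
    f-nonneg   : ∀ S → 0ℝ ≤ℝ f S
    f-∅        : f ⊥ ≃ℝ 0ℝ
    monotone   : Monotone f
    submodular : Submodular f

-- A partition of the jobs into `size` sets, given by the set each job belongs
-- to.  Sets may be empty: f ∅ = 0 < V, so allowing this affects neither
-- feasibility nor the minimum size.
record Partition (N : ℕ) : Set where
  field
    size   : ℕ
    assign : Fin N → Fin size

  block : Fin size → Subset N
  block j = tabulate λ i → does (assign i ≟ j)

Feasible : ∀ {N} → Instance N → Partition N → Set
Feasible I P = ∀ j → f (block j) ≤ℝ V
  where
  open Instance I
  open Partition P

IsOPT : ∀ {N} → Instance N → ℕ → Set
IsOPT {N} I opt =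
  (Σ[ P ∈ Partition N ] Feasible I P × Partition.size P ≡ opt) ×
  (∀ (P : Partition N) → Feasible I P → opt ℕ.≤ Partition.size P)

-- An adaptive strategy on ground set [N]: each oracle answer determines how
-- to continue, with no restriction on the computation between queries.
-- Continuations may depend on the representative of the real returned, not
-- just on its ≃ℝ-class; this only makes the strategies more powerful.
data Strategy (N : ℕ) : Set where
  output : Partition N → Strategy N
  query  : Subset N → (ℝ → Strategy N) → Strategy N

result : ∀ {N} → Strategy N → SetFunction N → Partition N
result (output P)  f = P
result (query S k) f = result (k (f S)) f

#queries : ∀ {N} → Strategy N → SetFunction N → ℕ
#queries (output P)  f = 0
#queries (query S k) f = suc (#queries (k (f S)) f)

-- An algorithm is given N and the capacity V explicitly, and f by its oracle.
Algorithm : Set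
Algorithm = ∀ N → ℝ → Strategy N

solution : ∀ {N} → Algorithm → Instance N → Partition N
solution {N} alg I = result (alg N V) f
  where open Instance I

PolynomiallyManyQueries : Algorithm → Set
PolynomiallyManyQueries alg = ∃[ c ] ∃[ d ] ∀ N (I : Instance N) →
  #queries (alg N (Instance.V I)) (Instance.f I) ℕ.≤ c ℕ.* N ℕ.^ d ℕ.+ c

Guarantees : Algorithm → (ℕ → ℝ) → Set
Guarantees alg ρ = ∀ N (I : Instance N) → ∃ (Feasible I) →
  Feasible I (solution alg I) ×
  (∀ opt → IsOPT I opt → fromℕ (Partition.size (solution alg I)) ≤ℝ ρ N *ℝ fromℕ opt)

{-# OPTIONS --safe #-}

-- Fix a threshold V and compare the capacity f₀ S = min (V+1, ∣S∣) with
-- f_R S = min (V+1, min (V, ∣S ∩ R∣) + min (V, ∣S ∩ ∁ R∣)).  The two agree on S unless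
-- ∣S∣ > V and S lies inside R or inside ∁ R.  A random R leaves such an S on one side with
-- probability at most 2^(−V), so for fewer than 2^V queries some R makes the algorithm behave
-- identically on both functions.  Under f₀ its solution has at least N/V sets, whereas {R, ∁ R}
-- is optimal under f_R.  For N = 4^n and V linear in n the ratio N/(2V) is at least
-- 2√N ≥ √N / ln N, since ln N ≥ ½.
module Submission where

open import Defs
open import Data.Nat using (ℕ; _≤_)
open import Data.Product using (Σ-syntax; _×_)
open import Relation.Nullary using (¬_)

open import Data.Bool using (Bool; true; false; not; _∧_; if_then_else_)
import Data.Bool.Properties as Boolₚ
open import Data.Nat using (zero; suc; _+_; _*_; _^_; _<_; _⊓_; _<?_; z≤n; s≤s; >-nonZero)
open import Data.Nat.Properties
import Data.Nat.Tactic.RingSolver as ℕ-Ring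
open import Data.Rational as ℚ using (0ℚ; 1ℚ; ½)
import Data.Rational.Properties as ℚₚ
open import Data.Fin using (Fin; zero; suc)
import Data.Fin.Base as Fin using (fromℕ<)
import Data.Fin.Properties as Fin using (_≟_)
open import Data.Fin.Subset using (Subset; inside; outside; ⊥; ⊤; _∪_; _∩_; ∁; ∣_∣; _⊆_)
open import Data.Fin.Subset.Properties
open import Data.Vec using ([]; _∷_; lookup; replicate; tabulate)
open import Data.Vec.Properties using (tabulate-cong; tabulate∘lookup; lookup-map)
open import Data.List using (List; []; _∷_; length; map; filter)
open import Data.Nat.ListAction using (sum)
import Data.List.Properties as Listₚ
open import Data.List.Relation.Unary.All using (All; []; _∷_)
import Data.List.Relation.Unary.All as All
import Data.List.Relation.Unary.All.Properties as Allₚ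
open import Data.Product using (∃-syntax; _,_; proj₁; proj₂)
open import Data.Sum using (_⊎_; inj₁; inj₂)
open import Algebra.Properties.CommutativeMonoid.Sum +-0-commutativeMonoid
  using (∑-distrib-+; sum-cong-≗; sum-replicate-zero) renaming (sum to ∑)
open import Function using (_∘_)
open import Relation.Nullary using (Dec; ¬?; does; yes; no; contradiction)
open import Relation.Binary.PropositionalEquality

-- Submodular functions with natural values

record SubmodularRank (N : ℕ) : Set where
  field
    rank       : Subset N → ℕ
    rank-⊥     : rank ⊥ ≡ 0
    mono       : ∀ S T → S ⊆ T → rank S ≤ rank T
    submodular : ∀ S T → rank (S ∪ T) + rank (S ∩ T) ≤ rank S + rank T

open SubmodularRank

∣∪∣+∣∩∣ : ∀ {N} (S T : Subset N) → ∣ S ∪ T ∣ + ∣ S ∩ T ∣ ≡ ∣ S ∣ + ∣ T ∣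
∣∪∣+∣∩∣ []            []            = refl
∣∪∣+∣∩∣ (outside ∷ S) (outside ∷ T) = ∣∪∣+∣∩∣ S T
∣∪∣+∣∩∣ (outside ∷ S) (inside ∷ T)  = trans (cong suc (∣∪∣+∣∩∣ S T)) (sym (+-suc ∣ S ∣ ∣ T ∣))
∣∪∣+∣∩∣ (inside ∷ S)  (outside ∷ T) = cong suc (∣∪∣+∣∩∣ S T)
∣∪∣+∣∩∣ (inside ∷ S)  (inside ∷ T)  = cong suc (trans (+-suc ∣ S ∪ T ∣ ∣ S ∩ T ∣)
  (trans (cong suc (∣∪∣+∣∩∣ S T)) (sym (+-suc ∣ S ∣ ∣ T ∣))))

∩-monoˡ : ∀ {N} {S T : Subset N} R → S ⊆ T → S ∩ R ⊆ T ∩ R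
∩-monoˡ {S = S} {T} R S⊆T x∈ with x∈p∩q⁻ S R x∈
... | x∈S , x∈R = x∈p∩q⁺ (S⊆T x∈S , x∈R)

∩-distribʳ-∩ : ∀ {N} (R S T : Subset N) → (S ∩ T) ∩ R ≡ (S ∩ R) ∩ (T ∩ R)
∩-distribʳ-∩ []      []      []      = refl
∩-distribʳ-∩ (r ∷ R) (s ∷ S) (t ∷ T) = cong₂ _∷_ (head r s t) (∩-distribʳ-∩ R S T)
  where
  head : ∀ r s t → (s ∧ t) ∧ r ≡ (s ∧ r) ∧ (t ∧ r)
  head true  true  t = refl
  head false true  t = Boolₚ.∧-zeroʳ t
  head true  false t = refl
  head false false t = refl

cardinality : ∀ {N} → SubmodularRank N
cardinality {N} = record
  { rank       = ∣_∣
  ; rank-⊥     = ∣⊥∣≡0 N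
  ; mono       = λ _ _ → p⊆q⇒∣p∣≤∣q∣
  ; submodular = λ S T → ≤-reflexive (∣∪∣+∣∩∣ S T)
  }

cardinality-in : ∀ {N} → Subset N → SubmodularRank N
cardinality-in {N} R = record
  { rank       = λ S → ∣ S ∩ R ∣
  ; rank-⊥     = trans (cong ∣_∣ (∩-zeroˡ R)) (∣⊥∣≡0 N)
  ; mono       = λ S T S⊆T → p⊆q⇒∣p∣≤∣q∣ (∩-monoˡ R S⊆T)
  ; submodular = λ S T → ≤-reflexive (trans
      (cong₂ (λ A B → ∣ A ∣ + ∣ B ∣) (∩-distribʳ-∪ R S T) (∩-distribʳ-∩ R S T))
      (∣∪∣+∣∩∣ (S ∩ R) (T ∩ R)))
  }

infixl 6 _⊕_

_⊕_ : ∀ {N} → SubmodularRank N → SubmodularRank N → SubmodularRank N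
g ⊕ h = record
  { rank       = λ S → rank g S + rank h S
  ; rank-⊥     = cong₂ _+_ (rank-⊥ g) (rank-⊥ h)
  ; mono       = λ S T S⊆T → +-mono-≤ (mono g S T S⊆T) (mono h S T S⊆T)
  ; submodular = λ S T → subst₂ _≤_
      (interchange (rank g (S ∪ T)) (rank g (S ∩ T)) (rank h (S ∪ T)) (rank h (S ∩ T)))
      (interchange (rank g S) (rank g T) (rank h S) (rank h T))
      (+-mono-≤ (submodular g S T) (submodular h S T))
  }
  where
  interchange : ∀ a b c d → (a + b) + (c + d) ≡ (a + c) + (b + d)
  interchange = ℕ-Ring.solve-∀

-- Here `a` and `b` stand for the ranks of union and intersection. If `c` reaches the cap, `k ⊓ c`
-- is `k` and dominates `k ⊓ a`, while `k ⊓ d` dominates `k ⊓ b`; if `d` reaches it, exchange the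
-- two. Otherwise the right-hand side is `c + d`, and the caps only lower the left.
⊓-submodular : ∀ k {a b c d} → b ≤ c → b ≤ d → a + b ≤ c + d →
  k ⊓ a + k ⊓ b ≤ k ⊓ c + k ⊓ d
⊓-submodular k {a} {b} {c} {d} b≤c b≤d h with ≤-total k c | ≤-total k d
... | inj₁ k≤c | _ = +-mono-≤
  (subst (k ⊓ a ≤_) (sym (m≤n⇒m⊓n≡m k≤c)) (m⊓n≤m k a)) (⊓-monoʳ-≤ k b≤d)
... | inj₂ _ | inj₁ k≤d = subst (k ⊓ a + k ⊓ b ≤_) (+-comm (k ⊓ d) (k ⊓ c)) (+-mono-≤
  (subst (k ⊓ a ≤_) (sym (m≤n⇒m⊓n≡m k≤d)) (m⊓n≤m k a)) (⊓-monoʳ-≤ k b≤c))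
... | inj₂ c≤k | inj₂ d≤k = ≤-trans (+-mono-≤ (m⊓n≤n k a) (m⊓n≤n k b))
  (subst₂ (λ x y → a + b ≤ x + y) (sym (m≥n⇒m⊓n≡n c≤k)) (sym (m≥n⇒m⊓n≡n d≤k)) h)

truncate : ∀ {N} → ℕ → SubmodularRank N → SubmodularRank N
truncate k g = record
  { rank       = λ S → k ⊓ rank g S
  ; rank-⊥     = trans (cong (k ⊓_) (rank-⊥ g)) (⊓-zeroʳ k)
  ; mono       = λ S T S⊆T → ⊓-monoʳ-≤ k (mono g S T S⊆T)
  ; submodular = λ S T → ⊓-submodular k
      (mono g (S ∩ T) S (p∩q⊆p S T)) (mono g (S ∩ T) T (p∩q⊆q S T)) (submodular g S T)
  }

-- Real-valued instances

seq-≤⇒≤ℝ : ∀ {x y} → (∀ n → seq x n ℚ.≤ seq y n) → x ≤ℝ y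
seq-≤⇒≤ℝ {x} {y} h (ε , 0<ε , M , lt) = ℚₚ.<-irrefl refl (ℚₚ.<-≤-trans
  (subst (ℚ._< seq y M ℚ.+ ε) (ℚₚ.+-identityʳ (seq y M)) (ℚₚ.+-monoʳ-< (seq y M) 0<ε))
  (ℚₚ.≤-trans (lt M ≤-refl) (h M)))

frac-mono : ∀ {a b} → a ≤ b → frac a 0 ℚ.≤ frac b 0
frac-mono {a} {b} a≤b = frac-≤ {a} {0} {b} {0} (*-monoˡ-≤ 1 a≤b)

fromℕ-mono : ∀ {a b} → a ≤ b → fromℕ a ≤ℝ fromℕ b
fromℕ-mono {a} {b} a≤b = seq-≤⇒≤ℝ {fromℕ a} {fromℕ b} λ _ → frac-mono a≤b

fromℕ-< : ∀ {a b} → a < b → fromℕ a <ℝ fromℕ b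
fromℕ-< {a} {b} a<b = 1ℚ , 0<1 , 0 , λ _ _ →
  subst (ℚ._≤ frac b 0) (sym (trans (frac-+ a 1 0) (cong (λ z → frac z 0) (+-comm a 1))))
    (frac-mono a<b)

fromℕ-cancel-≤ : ∀ {a b} → fromℕ a ≤ℝ fromℕ b → a ≤ b
fromℕ-cancel-≤ a≤b = ≮⇒≥ λ b<a → a≤b (fromℕ-< b<a)

toInstance : ∀ {N} V → 0 < V → SubmodularRank N → Instance N
toInstance V 0<V g = record
  { V          = fromℕ V
  ; V-positive = fromℕ-< 0<V
  ; f          = λ S → fromℕ (rank g S)
  ; f-nonneg   = λ S → fromℕ-mono {0} {rank g S} z≤n
  ; f-∅        = fromℕ-mono {rank g ⊥} {0} (≤-reflexive (rank-⊥ g)) , fromℕ-mono {0} {rank g ⊥} z≤n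
  ; monotone   = λ S T S⊆T → fromℕ-mono {rank g S} {rank g T} (mono g S T S⊆T)
  ; submodular = λ S T →
      seq-≤⇒≤ℝ {fromℕ (rank g (S ∪ T)) +ℝ fromℕ (rank g (S ∩ T))} {fromℕ (rank g S) +ℝ fromℕ (rank g T)} λ _ →
      subst₂ ℚ._≤_ (sym (frac-+ (rank g (S ∪ T)) (rank g (S ∩ T)) 0)) (sym (frac-+ (rank g S) (rank g T) 0))
        (frac-mono (submodular g S T))
  }

-- Decision trees

queries : ∀ {N} → Strategy N → SetFunction N → List (Subset N)
queries (output P)  f = []
queries (query S k) f = S ∷ queries (k (f S)) f

length-queries : ∀ {N} (σ : Strategy N) f → length (queries σ f) ≡ #queries σ f
length-queries (output P)  f = refl
length-queries (query S k) f = cong suc (length-queries (k (f S)) f)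

-- Only the sets asked in the run on `f` are compared. A strategy may react to the representative of
-- a real, so agreement is taken in the sense of `_≡_`; each answer then leads to the same
-- continuation.
result-cong : ∀ {N} (σ : Strategy N) {f g} → All (λ S → f S ≡ g S) (queries σ f) →
  result σ f ≡ result σ g
result-cong (output P)  []                  = refl
result-cong (query S k) {f} {g} (eq ∷ eqs) =
  trans (result-cong (k (f S)) eqs) (cong (λ z → result (k z) g) eq)

-- Choosing the hidden set by conditional expectations

part : ∀ {N} → Bool → Subset N → Subset N
part true  R = R
part false R = ∁ R

Meets : ∀ {N} → Subset N → Bool × Subset N → Set
Meets R (b , S) = 0 < ∣ S ∩ part b R ∣

-- 2^(N − ∣S∣), the number of R such that S misses a prescribed part.
weight : ∀ {N} → Subset N → ℕ
weight []            = 1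
weight (inside ∷ S)  = weight S
weight (outside ∷ S) = 2 * weight S

-- In probabilistic terms, a uniformly random `R` leaves `S` disjoint from a prescribed part with
-- probability 2^(-∣S∣).
weight-∣∣ : ∀ {N} (S : Subset N) → weight S * 2 ^ ∣ S ∣ ≡ 2 ^ N
weight-∣∣ []            = refl
weight-∣∣ (inside ∷ S)  = trans (lem (weight S) (2 ^ ∣ S ∣)) (cong (2 *_) (weight-∣∣ S))
  where
  lem : ∀ a b → a * (2 * b) ≡ 2 * (a * b)
  lem = ℕ-Ring.solve-∀
weight-∣∣ (outside ∷ S) = trans (*-assoc 2 (weight S) (2 ^ ∣ S ∣)) (cong (2 *_) (weight-∣∣ S))

totalWeight : ∀ {N} → List (Bool × Subset N) → ℕ
totalWeight L = sum (map (weight ∘ proj₂) L)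

-- The constraints still unmet once the first element is put into part x.
residual : ∀ {N} → Bool → List (Bool × Subset (suc N)) → List (Bool × Subset N)
residual x [] = []
residual x ((b , outside ∷ S) ∷ L) = (b , S) ∷ residual x L
residual true  ((true  , inside ∷ S) ∷ L) = residual true L
residual true  ((false , inside ∷ S) ∷ L) = (false , S) ∷ residual true L
residual false ((true  , inside ∷ S) ∷ L) = (true , S) ∷ residual false L
residual false ((false , inside ∷ S) ∷ L) = residual false L

-- This conditions on the side of the first element. A set avoiding it stays in both residual lists
-- with half its weight; a set containing it is met on one side and survives on the other with its
-- full weight.
residual-weight : ∀ {N} (L : List (Bool × Subset (suc N))) →
  totalWeight (residual true L) + totalWeight (residual false L) ≡ totalWeight L
residual-weight [] = refl
residual-weight ((b , outside ∷ S) ∷ L) = trans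
  (lem (weight S) (totalWeight (residual true L)) (totalWeight (residual false L)))
  (cong (weight (outside ∷ S) +_) (residual-weight L))
  where
  lem : ∀ w a b → (w + a) + (w + b) ≡ 2 * w + (a + b)
  lem = ℕ-Ring.solve-∀
residual-weight ((true , inside ∷ S) ∷ L) = trans
  (lem (weight S) (totalWeight (residual true L)) (totalWeight (residual false L)))
  (cong (weight S +_) (residual-weight L))
  where
  lem : ∀ w a b → a + (w + b) ≡ w + (a + b)
  lem = ℕ-Ring.solve-∀
residual-weight ((false , inside ∷ S) ∷ L) = trans
  (+-assoc (weight S) (totalWeight (residual true L)) (totalWeight (residual false L)))
  (cong (weight S +_) (residual-weight L))

meets-∷ : ∀ {N} x s b (R S : Subset N) → Meets R (b , S) → Meets (x ∷ R) (b , s ∷ S)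
meets-∷ x s true  R S h = ≤-trans h (∣p∣≤∣x∷p∣ (s ∧ x) (S ∩ R))
meets-∷ x s false R S h = ≤-trans h (∣p∣≤∣x∷p∣ (s ∧ not x) (S ∩ ∁ R))

residual-meets : ∀ {N} x (R : Subset N) L → All (Meets R) (residual x L) → All (Meets (x ∷ R)) L
residual-meets x R [] ms = []
residual-meets x R ((b , outside ∷ S) ∷ L) (m ∷ ms) = meets-∷ x outside b R S m ∷ residual-meets x R L ms
-- The dropped constraint is met by the first element itself.
residual-meets true  R ((true  , inside ∷ S) ∷ L) ms = s≤s z≤n ∷ residual-meets true R L ms
residual-meets true  R ((false , inside ∷ S) ∷ L) (m ∷ ms) = meets-∷ true inside false R S m ∷ residual-meets true R L ms
residual-meets false R ((true  , inside ∷ S) ∷ L) (m ∷ ms) = meets-∷ false inside true R S m ∷ residual-meets false R L ms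
residual-meets false R ((false , inside ∷ S) ∷ L) ms = s≤s z≤n ∷ residual-meets false R L ms

-- `totalWeight L` divided by 2^N is the expected number of unmet constraints for a random `R`. It
-- is the average of its two conditional values, so some side for the first element keeps it below
-- 1.
transversal : ∀ {N} (L : List (Bool × Subset N)) → totalWeight L < 2 ^ N → ∃[ R ] All (Meets R) L
transversal {zero} [] _ = [] , []
-- On an empty ground set every constraint has weight 1, against a total below 1.
transversal {zero} ((_ , []) ∷ L) (s≤s ())
transversal {suc N} L lt with totalWeight (residual true L) <? 2 ^ N
... | yes t = let R , ms = transversal (residual true L) t in true ∷ R , residual-meets true R L ms
... | no ¬t = let R , ms = transversal (residual false L) f in false ∷ R , residual-meets false R L ms
  where
  f : totalWeight (residual false L) < 2 ^ N
  -- The two residual weights sum to less than 2 · 2^N, and the first is at least 2^N.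
  f = +-cancelˡ-< (2 ^ N) _ _ (≤-<-trans (+-monoˡ-≤ _ (≮⇒≥ ¬t))
    (subst₂ _<_ (sym (residual-weight L)) (cong (_+_ (2 ^ N)) (+-identityʳ (2 ^ N))) lt))

Splits : ∀ {N} → Subset N → Subset N → Set
Splits R S = 0 < ∣ S ∩ R ∣ × 0 < ∣ S ∩ ∁ R ∣

bothParts : ∀ {N} → List (Subset N) → List (Bool × Subset N)
bothParts []      = []
bothParts (S ∷ L) = (true , S) ∷ (false , S) ∷ bothParts L

splits : ∀ {N} (R : Subset N) L → All (Meets R) (bothParts L) → All (Splits R) L
splits R []      []            = []
splits R (S ∷ L) (t ∷ f ∷ ms) = (t , f) ∷ splits R L ms

-- A union bound: since ∣S∣ ≥ V + 1, each of the two constraints from `S` has weight at most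
-- 2^(N-V-1), so together they weigh at most 2^(N-V).
bothParts-weight : ∀ {N} V (L : List (Subset N)) → All (λ S → V < ∣ S ∣) L →
  totalWeight (bothParts L) * 2 ^ V ≤ length L * 2 ^ N
bothParts-weight V [] [] = z≤n
bothParts-weight {N} V (S ∷ L) (V<S ∷ large) = begin
  (w + (w + t)) * 2 ^ V          ≡⟨ lem w t (2 ^ V) ⟩
  w * 2 ^ suc V + t * 2 ^ V      ≤⟨ +-mono-≤ (*-monoʳ-≤ w (^-monoʳ-≤ 2 V<S)) (bothParts-weight V L large) ⟩
  w * 2 ^ ∣ S ∣ + length L * 2 ^ N ≡⟨ cong (_+ length L * 2 ^ N) (weight-∣∣ S) ⟩
  2 ^ N + length L * 2 ^ N       ∎
  where
  open ≤-Reasoning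
  w = weight S
  t = totalWeight (bothParts L)
  lem : ∀ w t p → (w + (w + t)) * p ≡ w * (2 * p) + t * p
  lem = ℕ-Ring.solve-∀

splitting-set : ∀ {N} V (L : List (Subset N)) → length L < 2 ^ V →
  ∃[ R ] All (λ S → V < ∣ S ∣ → Splits R S) L
splitting-set {N} V L short =
  let R , ms = transversal (bothParts large) light in
  R , Allₚ.filter⁻ large?
    (All.map (λ Sp _ → Sp) (splits R large ms))
    -- For sets of at most `V` elements the implication is vacuous.
    (All.map (λ V≮S V<S → contradiction V<S V≮S) (Allₚ.all-filter (¬? ∘ large?) L))
  where
  large? : (S : Subset N) → Dec (V < ∣ S ∣)
  large? S = V <? ∣ S ∣
  large = filter large? L
  light : totalWeight (bothParts large) < 2 ^ N
  light = *-cancelʳ-< (2 ^ V) _ _ (≤-<-trans (bothParts-weight V large (Allₚ.all-filter large? L))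
    (≤-<-trans (*-monoˡ-≤ (2 ^ N) (Listₚ.length-filter large? L))
      (subst (length L * 2 ^ N <_) (*-comm (2 ^ V) (2 ^ N)) (*-monoˡ-< (2 ^ N) ⦃ m^n≢0 2 N ⦄ short))))

-- The indistinguishable pair of instances

plain : ∀ {N} → ℕ → SubmodularRank N
plain V = truncate (suc V) cardinality

-- The inner caps let `R` and `∁ R` each fit on one machine, whatever their size. The outer cap
-- gives all sets too large for one machine the same value V + 1.
hidden : ∀ {N} → ℕ → Subset N → SubmodularRank N
hidden V R = truncate (suc V) (truncate V (cardinality-in R) ⊕ truncate V (cardinality-in (∁ R)))

∣∩∣+∣∩∁∣ : ∀ {N} (S R : Subset N) → ∣ S ∩ R ∣ + ∣ S ∩ ∁ R ∣ ≡ ∣ S ∣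
∣∩∣+∣∩∁∣ []            []            = refl
∣∩∣+∣∩∁∣ (outside ∷ S) (x ∷ R)       = ∣∩∣+∣∩∁∣ S R
∣∩∣+∣∩∁∣ (inside ∷ S)  (inside ∷ R)  = cong suc (∣∩∣+∣∩∁∣ S R)
∣∩∣+∣∩∁∣ (inside ∷ S)  (outside ∷ R) = trans (+-suc _ _) (cong suc (∣∩∣+∣∩∁∣ S R))

-- If neither summand exceeds `V`, the inner caps are inactive. If one does, it still contributes
-- `V` and the other, being positive, at least 1, so both sides equal V + 1.
⊓-cap-+ : ∀ V {a b} → 0 < V → (V < a + b → 0 < a × 0 < b) → suc V ⊓ (a + b) ≡ suc V ⊓ (V ⊓ a + V ⊓ b)
⊓-cap-+ V {a} {b} 0<V pos with V <? a | V <? b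
... | no V≮a | no V≮b = cong (suc V ⊓_)
  (sym (cong₂ _+_ (m≥n⇒m⊓n≡n (≮⇒≥ V≮a)) (m≥n⇒m⊓n≡n (≮⇒≥ V≮b))))
... | yes V<a | _ = trans (m≤n⇒m⊓n≡m V<a+b) (sym (m≤n⇒m⊓n≡m V<caps))
  where
  V<a+b = ≤-trans V<a (m≤m+n a b)
  V<caps : suc V ≤ V ⊓ a + V ⊓ b
  V<caps = subst₂ _≤_ (+-comm V 1) (cong (_+ V ⊓ b) (sym (m≤n⇒m⊓n≡m (<⇒≤ V<a))))
    (+-monoʳ-≤ V (⊓-glb 0<V (proj₂ (pos V<a+b))))
... | no _ | yes V<b = trans (m≤n⇒m⊓n≡m V<a+b) (sym (m≤n⇒m⊓n≡m V<caps))
  where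
  V<a+b = ≤-trans V<b (m≤n+m b a)
  V<caps : suc V ≤ V ⊓ a + V ⊓ b
  V<caps = subst (λ z → suc V ≤ V ⊓ a + z) (sym (m≤n⇒m⊓n≡m (<⇒≤ V<b)))
    (+-monoˡ-≤ V (⊓-glb 0<V (proj₁ (pos V<a+b))))

plain≡hidden : ∀ {N} V (R S : Subset N) → 0 < V → (V < ∣ S ∣ → Splits R S) →
  rank (plain V) S ≡ rank (hidden V R) S
plain≡hidden V R S 0<V split = trans (cong (suc V ⊓_) (sym (∣∩∣+∣∩∁∣ S R)))
  (⊓-cap-+ V 0<V λ V<S → split (subst (V <_) (∣∩∣+∣∩∁∣ S R) V<S))

-- Feasible partitions and optimal values

singletons : ∀ N → Partition N
singletons N = record { size = N ; assign = λ i → i }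

tabulate-const : ∀ {A : Set} N (x : A) → tabulate {n = N} (λ _ → x) ≡ replicate N x
tabulate-const zero    x = refl
tabulate-const (suc N) x = cong (x ∷_) (tabulate-const N x)

∣tabulate-≟∣≤1 : ∀ {N} (j : Fin N) → ∣ tabulate (λ i → does (i Fin.≟ j)) ∣ ≤ 1
∣tabulate-≟∣≤1 {suc N} zero    = s≤s (≤-reflexive (trans (cong ∣_∣ (tabulate-const N outside)) (∣⊥∣≡0 N)))
∣tabulate-≟∣≤1 {suc N} (suc j) = ∣tabulate-≟∣≤1 j

-- The guarantee speaks only of instances that admit a feasible partition; this provides one for the
-- plain instance.
singletons-feasible : ∀ {N V} (0<V : 0 < V) → Feasible (toInstance {N} V 0<V (plain V)) (singletons N)
singletons-feasible {N} {V} 0<V j = fromℕ-mono (≤-trans (m⊓n≤n (suc V) _) (≤-trans (∣tabulate-≟∣≤1 j) 0<V))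

indicator : Bool → ℕ
indicator b = if b then 1 else 0

∑-indicator : ∀ {s} (k : Fin s) → ∑ (λ j → indicator (does (k Fin.≟ j))) ≡ 1
∑-indicator {suc s} zero    = cong suc (sum-replicate-zero s)
∑-indicator {suc s} (suc k) = ∑-indicator k

∣∷∣ : ∀ {N} b (p : Subset N) → ∣ b ∷ p ∣ ≡ indicator b + ∣ p ∣
∣∷∣ true  p = refl
∣∷∣ false p = refl

-- Induction on the jobs: the first one adds 1 to exactly one block.
∑-∣block∣ : ∀ {N s} (a : Fin N → Fin s) → ∑ (λ j → ∣ tabulate (λ i → does (a i Fin.≟ j)) ∣) ≡ N
∑-∣block∣ {zero}  {s} a = sum-replicate-zero s
∑-∣block∣ {suc N} {s} a = trans
  (sum-cong-≗ (λ j → ∣∷∣ (does (a zero Fin.≟ j)) (tabulate (λ i → does (a (suc i) Fin.≟ j)))))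
  (trans (∑-distrib-+ (λ j → indicator (does (a zero Fin.≟ j))) (λ j → ∣ tabulate (λ i → does (a (suc i) Fin.≟ j)) ∣))
    (cong₂ _+_ (∑-indicator (a zero)) (∑-∣block∣ (a ∘ suc))))

∑-≤ : ∀ {s V} (t : Fin s → ℕ) → (∀ j → t j ≤ V) → ∑ t ≤ s * V
∑-≤ {zero}  t h = z≤n
∑-≤ {suc s} t h = +-mono-≤ (h zero) (∑-≤ (t ∘ suc) (h ∘ suc))

plain-feasible⇒≤ : ∀ {N V} (0<V : 0 < V) (P : Partition N) →
  Feasible (toInstance V 0<V (plain V)) P → N ≤ Partition.size P * V
plain-feasible⇒≤ {N} {V} 0<V P feas = subst (_≤ size * V) (∑-∣block∣ assign)
  (∑-≤ (λ j → ∣ block j ∣) λ j → fits (fromℕ-cancel-≤ {suc V ⊓ ∣ block j ∣} {V} (feas j)))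
  where
  open Partition P
  -- The cap lies one above `V`, so an oversized block still violates the capacity.
  fits : ∀ {x} → suc V ⊓ x ≤ V → x ≤ V
  fits {x} h = ≮⇒≥ λ V<x → 1+n≰n (subst (_≤ V) (m≤n⇒m⊓n≡m V<x) h)

twoParts : ∀ {N} → Subset N → Partition N
twoParts R = record { size = 2 ; assign = λ i → if lookup R i then zero else suc zero }

twoParts-block : ∀ {N} (R : Subset N) j → Partition.block (twoParts R) j ≡ R ⊎ Partition.block (twoParts R) j ≡ ∁ R
twoParts-block R zero = inj₁ (trans (tabulate-cong (λ i → lem (lookup R i))) (tabulate∘lookup R))
  where
  lem : ∀ b → does ((if b then zero else suc zero) Fin.≟ zero {1}) ≡ b
  lem true  = refl
  lem false = refl
twoParts-block R (suc zero) = inj₂ (trans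
  (tabulate-cong (λ i → trans (lem (lookup R i)) (sym (lookup-map i not R))))
  (tabulate∘lookup (∁ R)))
  where
  lem : ∀ b → does ((if b then zero else suc zero) Fin.≟ suc {1} zero) ≡ not b
  lem true  = refl
  lem false = refl

twoParts-feasible : ∀ {N V} (0<V : 0 < V) (R : Subset N) →
  Feasible (toInstance V 0<V (hidden V R)) (twoParts R)
twoParts-feasible {N} {V} 0<V R j = fromℕ-mono (≤-trans (m⊓n≤n (suc V) _) (fits (twoParts-block R j)))
  where
  B = Partition.block (twoParts R) j
  fits : B ≡ R ⊎ B ≡ ∁ R → V ⊓ ∣ B ∩ R ∣ + V ⊓ ∣ B ∩ ∁ R ∣ ≤ V
  fits (inj₁ eq) rewrite eq | ∩-inverseʳ R | ∣⊥∣≡0 N | ⊓-zeroʳ V | +-identityʳ (V ⊓ ∣ R ∩ R ∣) = m⊓n≤m V _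
  fits (inj₂ eq) rewrite eq | ∩-inverseˡ R | ∣⊥∣≡0 N | ⊓-zeroʳ V = m⊓n≤m V _

-- A single block would be all of `⊤`. As `R` splits `⊤`, its hidden rank equals its plain rank,
-- which is V + 1 because `V < N`.
hidden-OPT : ∀ {N V} (0<V : 0 < V) (R : Subset N) → V < N → Splits R ⊤ →
  IsOPT (toInstance V 0<V (hidden V R)) 2
hidden-OPT {N} {V} 0<V R V<N split = (twoParts R , twoParts-feasible 0<V R , refl) , λ P feas →
  lower (Partition.size P) (Partition.assign P) feas
  where
  lower : ∀ s (a : Fin N → Fin s) → Feasible (toInstance V 0<V (hidden V R)) (record { size = s ; assign = a }) → 2 ≤ s
  -- `V < N` supplies a job, which no set could receive.
  lower zero a _ with a (Fin.fromℕ< V<N)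
  ... | ()
  lower (suc zero) a feas = contradiction full (≤⇒≯ (fromℕ-cancel-≤ {rank (hidden V R) ⊤} {V}
      (subst (λ B → fromℕ (rank (hidden V R) B) ≤ℝ fromℕ V) all (feas zero))))
    where
    same : ∀ (k : Fin 1) → does (k Fin.≟ zero) ≡ inside
    same zero = refl
    all : tabulate (λ i → does (a i Fin.≟ zero)) ≡ ⊤
    all = trans (tabulate-cong (λ i → same (a i))) (tabulate-const N inside)
    full : V < rank (hidden V R) ⊤
    full = subst (V <_) (plain≡hidden V R ⊤ 0<V (λ _ → split))
      (⊓-glb ≤-refl (subst (V <_) (sym (∣⊤∣≡n N)) V<N))
  lower (suc (suc s)) a _ = s≤s (s≤s z≤n)

-- Numerical estimates

√-≤ : ∀ m n → seq (√ (m * m)) n ℚ.≤ frac m 0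
√-≤ m n = frac-≤ {r} {n} {m} {0} (subst (_≤ m * suc n) (sym (*-identityʳ r)) (≮⇒≥ λ lt →
  <-irrefl refl (<-≤-trans (*-mono-< lt lt)
    (≤-trans (⌊√⌋-lower (m * m * (suc n * suc n))) (≤-reflexive (lem m (suc n)))))))
  where
  r = ⌊√ m * m * (suc n * suc n) ⌋
  lem : ∀ m n → m * m * (n * n) ≡ (m * n) * (m * n)
  lem = ℕ-Ring.solve-∀

½≤⇒1/≤2 : ∀ p .⦃ _ : ℚ.NonZero p ⦄ → ½ ℚ.≤ p → ℚ.1/ p ℚ.≤ 1ℚ ℚ.+ 1ℚ
½≤⇒1/≤2 p ½≤p = ℚₚ.*-cancelˡ-≤-pos p ⦃ ℚ.positive (ℚₚ.<-≤-trans (ℚₚ.positive⁻¹ ½) ½≤p) ⦄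
  (subst (ℚ._≤ p ℚ.* (1ℚ ℚ.+ 1ℚ)) (sym (ℚₚ.*-inverseʳ p)) (ℚₚ.*-monoʳ-≤-nonNeg (1ℚ ℚ.+ 1ℚ) ½≤p))

-- ln-pos exhibits ½ as a lower bound of ln N, so inv truncates at ½.
inv-ln≤2 : ∀ N (2≤N : 2 ≤ N) n → seq (inv (ln N) (ln-pos 2≤N)) n ℚ.≤ 1ℚ ℚ.+ 1ℚ
inv-ln≤2 (suc (suc N)) (s≤s (s≤s z≤n)) n =
  ½≤⇒1/≤2 (½ ℚ.⊔ x) ⦃ ⊔-nonZero (ℚₚ.positive⁻¹ ½) x ⦄ (ℚₚ.p≤p⊔q ½ x)
  where x = lnSum (suc (suc N)) n

*2 : ∀ p → p ℚ.* (1ℚ ℚ.+ 1ℚ) ≡ p ℚ.+ p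
*2 p = trans (ℚₚ.*-distribˡ-+ p 1ℚ 1ℚ) (cong₂ ℚ._+_ (ℚₚ.*-identityʳ p) (ℚₚ.*-identityʳ p))

√/ln≤ : ∀ m (2≤N : 2 ≤ m * m) n → seq ((√ (m * m)) /ℝ ln (m * m) ⟨ ln-pos 2≤N ⟩) n ℚ.≤ frac (m + m) 0
√/ln≤ m 2≤N n = begin
  s ℚ.* seq (inv (ln (m * m)) (ln-pos 2≤N)) n ≤⟨ ℚₚ.*-monoˡ-≤-nonNeg s ⦃ ℚ.nonNegative (0≤frac ⌊√ m * m * (suc n * suc n) ⌋ n) ⦄ (inv-ln≤2 (m * m) 2≤N n) ⟩
  s ℚ.* (1ℚ ℚ.+ 1ℚ)                           ≡⟨ *2 s ⟩
  s ℚ.+ s                                     ≤⟨ ℚₚ.+-mono-≤ (√-≤ m n) (√-≤ m n) ⟩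
  frac m 0 ℚ.+ frac m 0                       ≡⟨ frac-+ m m 0 ⟩
  frac (m + m) 0                              ∎
  where
  open ℚₚ.≤-Reasoning
  s = seq (√ (m * m)) n

-- The 4 is a factor 2 from the optimum times a factor 2 from 1 / ln N ≤ 2. If `size` were at least
-- 4m, the gap `ε` between `ρ` and √N / ln N would also separate 2ρ from `size`.
size-bound : ∀ m {ρ size} (2≤N : 2 ≤ m * m) → ρ <ℝ (√ (m * m)) /ℝ ln (m * m) ⟨ ln-pos 2≤N ⟩ →
  fromℕ size ≤ℝ ρ *ℝ fromℕ 2 → size < (m + m) + (m + m)
size-bound m {ρ} {size} 2≤N (ε , 0<ε , M , lt) le = ≰⇒> λ 4m≤size → le (ε , 0<ε , M , λ n M≤n →
  let r = seq ρ n
      r+ε≤ = ℚₚ.≤-trans (lt n M≤n) (√/ln≤ m 2≤N n) in begin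
  r ℚ.* (1ℚ ℚ.+ 1ℚ) ℚ.+ ε            ≡⟨ cong (ℚ._+ ε) (*2 r) ⟩
  r ℚ.+ r ℚ.+ ε                      ≡⟨ ℚₚ.+-assoc r r ε ⟩
  r ℚ.+ (r ℚ.+ ε)                    ≡⟨ cong (ℚ._+ (r ℚ.+ ε)) (sym (ℚₚ.+-identityʳ r)) ⟩
  -- A second `ε` is added so that the bound on r + ε serves both summands.
  r ℚ.+ 0ℚ ℚ.+ (r ℚ.+ ε)             ≤⟨ ℚₚ.+-monoˡ-≤ (r ℚ.+ ε) (ℚₚ.+-monoʳ-≤ r (ℚₚ.<⇒≤ 0<ε)) ⟩
  r ℚ.+ ε ℚ.+ (r ℚ.+ ε)              ≤⟨ ℚₚ.+-mono-≤ r+ε≤ r+ε≤ ⟩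
  frac (m + m) 0 ℚ.+ frac (m + m) 0  ≡⟨ frac-+ (m + m) (m + m) 0 ⟩
  frac ((m + m) + (m + m)) 0         ≤⟨ frac-mono 4m≤size ⟩
  frac size 0                        ∎)
  where open ℚₚ.≤-Reasoning

-- Choice of parameters and the contradiction

n<2^n : ∀ n → n < 2 ^ n
n<2^n zero    = s≤s z≤n
n<2^n (suc n) = ≤-trans (s≤s (n<2^n n))
  (subst (suc (2 ^ n) ≤_) (cong (2 ^ n +_) (sym (+-identityʳ (2 ^ n)))) (+-monoˡ-≤ (2 ^ n) (m^n>0 2 n)))

-- With N = 4^n, the power N^d is exactly 2^(2nd); the remaining c + 1 in the exponent absorbs the
-- coefficients, since 2(c + 1) ≤ 2^(c+1). The outer `suc` makes room for `⊤` beside the queried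
-- sets.
queries<2^ : ∀ n c d → suc (c * (2 ^ n * 2 ^ n) ^ d + c) < 2 ^ ((n + n) * d + suc c)
queries<2^ n c d = begin-strict
  suc (c * (2 ^ n * 2 ^ n) ^ d + c) ≡⟨ cong (λ z → suc (c * z + c)) pow ⟩
  suc (c * X + c)                   ≡⟨ lem₁ c X ⟩
  c * X + suc c * 1                 ≤⟨ +-monoʳ-≤ (c * X) (*-monoʳ-≤ (suc c) (m^n>0 2 ((n + n) * d))) ⟩
  c * X + suc c * X                 <⟨ +-monoˡ-< (suc c * X) (*-monoˡ-< X ⦃ m^n≢0 2 ((n + n) * d) ⦄ (n<1+n c)) ⟩
  suc c * X + suc c * X             ≤⟨ +-mono-≤ (*-monoˡ-≤ X (n<2^n c)) (*-monoˡ-≤ X (n<2^n c)) ⟩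
  2 ^ c * X + 2 ^ c * X             ≡⟨ lem₂ (2 ^ c) X ⟩
  X * 2 ^ suc c                     ≡⟨ sym (^-distribˡ-+-* 2 ((n + n) * d) (suc c)) ⟩
  2 ^ ((n + n) * d + suc c)         ∎
  where
  open ≤-Reasoning
  X = 2 ^ ((n + n) * d)
  pow : (2 ^ n * 2 ^ n) ^ d ≡ X
  pow = trans (cong (_^ d) (sym (^-distribˡ-+-* 2 n n))) (^-*-assoc 2 (n + n) d)
  lem₁ : ∀ c X → suc (c * X + c) ≡ c * X + suc c * 1
  lem₁ = ℕ-Ring.solve-∀
  lem₂ : ∀ a X → a * X + a * X ≡ X * (2 * a)
  lem₂ = ℕ-Ring.solve-∀

-- n = 2k with k = 4 (2d + c + 1) makes 4V ≤ n k = 2 k² ≤ 2^(2k).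
capacity-small : ∀ c d → let n = 8 * (d + d + suc c) in 4 * ((n + n) * d + suc c) ≤ 2 ^ n
capacity-small c d = begin
  4 * ((n + n) * d + suc c)     ≤⟨ *-monoʳ-≤ 4 (+-monoʳ-≤ ((n + n) * d) (m≤n*m (suc c) n)) ⟩
  4 * ((n + n) * d + n * suc c) ≡⟨ lem₁ (d + d + suc c) d (suc c) refl ⟩
  2 * (k * k)                   ≤⟨ *-monoʳ-≤ 2 (*-mono-≤ k≤ k≤) ⟩
  2 * (2 ^ k′ * 2 ^ k′)         ≤⟨ m≤n*m (2 * (2 ^ k′ * 2 ^ k′)) 2 ⟩
  2 * (2 * (2 ^ k′ * 2 ^ k′))   ≡⟨ lem₂ (2 ^ k′) ⟩
  2 ^ suc k′ * 2 ^ suc k′       ≡⟨ sym (^-distribˡ-+-* 2 (suc k′) (suc k′)) ⟩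
  2 ^ (suc k′ + suc k′)         ≡⟨ cong (2 ^_) (lem₃ c d) ⟩
  2 ^ n                         ∎
  where
  open ≤-Reasoning
  n = 8 * (d + d + suc c)
  k = 4 * (d + d + suc c)
  k′ = 4 * (d + d + c) + 3
  instance
    n≠0 = >-nonZero {n} (≤-trans (≤-trans (s≤s z≤n) (m≤n+m (suc c) (d + d))) (m≤n*m (d + d + suc c) 8))
  k≤ : k ≤ 2 ^ k′
  k≤ = subst (_≤ 2 ^ k′) (lem c d) (n<2^n k′)
    where
    lem : ∀ c d → suc (4 * (d + d + c) + 3) ≡ 4 * (d + d + suc c)
    lem = ℕ-Ring.solve-∀
  lem₁ : ∀ t d c′ → d + d + c′ ≡ t → 4 * ((8 * t + 8 * t) * d + 8 * t * c′) ≡ 2 * (4 * t * (4 * t))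
  lem₁ _ d c′ refl = lem d c′
    where
    lem : ∀ d c′ → 4 * ((8 * (d + d + c′) + 8 * (d + d + c′)) * d + 8 * (d + d + c′) * c′) ≡ 2 * (4 * (d + d + c′) * (4 * (d + d + c′)))
    lem = ℕ-Ring.solve-∀
  lem₂ : ∀ a → 2 * (2 * (a * a)) ≡ 2 * a * (2 * a)
  lem₂ = ℕ-Ring.solve-∀
  lem₃ : ∀ c d → suc (4 * (d + d + c) + 3) + suc (4 * (d + d + c) + 3) ≡ 8 * (d + d + suc c)
  lem₃ = ℕ-Ring.solve-∀

-- The same partition is judged twice: plain capacities force N ≤ size · V, while the guarantee on
-- the hidden instance, whose optimum is 2, forces size < 4m. With 4V ≤ m this gives m² < m².
lower-bound : ∀ m V (alg : Algorithm) ρ (0<V : 0 < V) → 4 * V ≤ m →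
  suc (#queries (alg (m * m) (fromℕ V)) (Instance.f (toInstance V 0<V (plain V)))) < 2 ^ V →
  (∀ N (2≤N : 2 ≤ N) → ρ N <ℝ (√ N) /ℝ ln N ⟨ ln-pos 2≤N ⟩) → ¬ Guarantees alg ρ
lower-bound m V alg ρ 0<V 4V≤m few ρ-small guarantee = <-irrefl refl (begin-strict
  m * m                     ≤⟨ plain-feasible⇒≤ 0<V P (proj₁ (guarantee N I₀ (singletons N , singletons-feasible 0<V))) ⟩
  size * V                  <⟨ *-monoˡ-< V ⦃ >-nonZero 0<V ⦄ size<4m ⟩
  ((m + m) + (m + m)) * V   ≡⟨ lem m V ⟩
  m * (4 * V)               ≤⟨ *-monoʳ-≤ m 4V≤m ⟩
  m * m                     ∎)
  where
  open ≤-Reasoning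
  N = m * m
  4≤m : 4 ≤ m
  4≤m = ≤-trans (*-monoʳ-≤ 4 0<V) 4V≤m
  m≤N : m ≤ N
  m≤N = m≤m*n m m ⦃ >-nonZero (≤-trans (s≤s z≤n) 4≤m) ⦄
  2≤N : 2 ≤ N
  2≤N = ≤-trans (s≤s (s≤s z≤n)) (≤-trans 4≤m m≤N)
  V<N : V < N
  V<N = <-≤-trans (m<m+n V (≤-trans 0<V (m≤m+n V _))) (≤-trans 4V≤m m≤N)
  I₀ : Instance N
  I₀ = toInstance V 0<V (plain V)
  σ = alg N (fromℕ V)
  P = solution alg I₀
  size = Partition.size P
  asked = queries σ (Instance.f I₀)
  lem : ∀ m V → ((m + m) + (m + m)) * V ≡ m * (4 * V)
  lem = ℕ-Ring.solve-∀
  size<4m : size < (m + m) + (m + m)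
  size<4m =
    -- `⊤` joins the queried sets so that `R` splits it too, as the optimum of the hidden instance
    -- requires.
    let R , split = splitting-set V (⊤ ∷ asked)
          (subst (λ q → suc q < 2 ^ V) (sym (length-queries σ (Instance.f I₀))) few)
    in conclude R split
    where
    conclude : ∀ R → All (λ S → V < ∣ S ∣ → Splits R S) (⊤ ∷ asked) → size < (m + m) + (m + m)
    conclude R (split⊤ ∷ split) = size-bound m {ρ N} {size} 2≤N (ρ-small N 2≤N)
      (subst (λ P → fromℕ (Partition.size P) ≤ℝ ρ N *ℝ fromℕ 2) (sym same)
        (proj₂ (guarantee N I₁ (twoParts R , twoParts-feasible 0<V R)) 2
          (hidden-OPT 0<V R V<N (split⊤ (subst (V <_) (sym (∣⊤∣≡n N)) V<N)))))
      where
      I₁ : Instance N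
      I₁ = toInstance V 0<V (hidden V R)
      same : P ≡ solution alg I₁
      same = result-cong σ (All.map (λ {S} sp → cong fromℕ (plain≡hidden V R S 0<V sp)) split)

theorem1 : ¬ (Σ[ alg ∈ Algorithm ] Σ[ ρ ∈ (ℕ → ℝ) ]
    PolynomiallyManyQueries alg ×
    (∀ N (2≤N : 2 ≤ N) → ρ N <ℝ (√ N) /ℝ ln N ⟨ ln-pos 2≤N ⟩) ×
    Guarantees alg ρ)
theorem1 (alg , ρ , (c , d , few) , ρ-small , guarantee) =
  lower-bound (2 ^ n) V alg ρ 0<V (capacity-small c d)
    (≤-<-trans (s≤s (few (2 ^ n * 2 ^ n) (toInstance V 0<V (plain V)))) (queries<2^ n c d))
    ρ-small guarantee
  where
  n = 8 * (d + d + suc c)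
  -- The exponent of the query bound. It is logarithmic in N = 4^n, so a large `n` makes 4V at most
  -- √N = 2^n.
  V = (n + n) * d + suc c
  0<V : 0 < V
  0<V = ≤-trans (s≤s z≤n) (m≤n+m (suc c) ((n + n) * d))
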